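{- For every integer $n\geq 0$, \begin{align*} \overline{p}_{ -11}(8n+1) &\equiv 0 \pmod{2}, & \overline{p}_{ -11}(8n+2) &\equiv 0 \pmod{8}, & \overline{p}_{ -11}(8n+3) &\equiv 0 \pmod{16}, \\ \overline{p}_{ -11}(8n+4) &\equiv 0 \pmod{2}, & \overline{p}_{ -11}(8n+7) &\equiv 0 \pmod{64}. \end{align*}
   Context: For $|q|<1$ let $(a;q)_\infty=\prod_{i\geq 0}(1-aq^i)$. For a positive integer $t$, the number $\overline{p}_{ -t}(n)$ of $t$-colored overpartitions of $n$ is defined by the generating function \[ \sum_{n\geq 0}\overline{p}_{ -t}(n)q^n=\frac{(q^2;q^2)_\infty^t}{(q;q)_\infty^{2t}}. \] -}

module Defs where

open import Data.Nat using (ℕ; zero; suc; _∸_; _≡ᵇ_)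
open import Data.Integer using (ℤ; +_; -_; _+_; _*_)
open import Data.List using (List; []; _∷_; map; zipWith; upTo; foldr)
open import Data.Bool using (if_then_else_)

Series : Set
Series = ℕ → ℤ

sumTo : ℕ → (ℕ → ℤ) → ℤ
sumTo zero    f = f zero
sumTo (suc n) f = sumTo n f + f (suc n)

_⊛_ : Series → Series → Series
(f ⊛ g) n = sumTo n (λ k → f k * g (n ∸ k))

oneS : Series
oneS zero    = + 1
oneS (suc _) = + 0

powS : Series → ℕ → Series
powS f zero    = oneS
powS f (suc t) = f ⊛ powS f t

-- the polynomial 1 - q^m  (m ≥ 1)
oneMinusQ : ℕ → Series
oneMinusQ m zero    = + 1
oneMinusQ m (suc n) = if suc n ≡ᵇ m then - (+ 1) else + 0

finPoch : ℕ → ℕ → Series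
finPoch d zero    = oneS
finPoch d (suc k) = finPoch d k ⊛ oneMinusQ (d Data.Nat.* suc k)

-- (q^d ; q^d)_∞ for d ≥ 1: the n-th coefficient of the infinite product
-- equals that of the finite product over i = 1..n (the other factors are
-- ≡ 1 mod q^{n+1}).
poch : ℕ → Series
poch d n = finPoch d n n

sumℤ : List ℤ → ℤ
sumℤ = foldr _+_ (+ 0)

-- Multiplicative inverse of a series with constant term 1:
-- b 0 = 1,  b (n+1) = - Σ_{k=1}^{n+1} a k * b (n+1-k).
-- invList a n = [b n, b (n-1), ..., b 0].
invList : Series → ℕ → List ℤ
invList a zero    = + 1 ∷ []
invList a (suc n) =
  let l = invList a n in
  (- sumℤ (zipWith _*_ (map (λ j → a (suc j)) (upTo (suc n))) l)) ∷ l

invS : Series → Series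
invS a n with invList a n
... | b ∷ _ = b
... | []    = + 0

pbarNeg : ℕ → ℕ → ℤ
pbarNeg t = powS (poch 2) t ⊛ invS (powS (poch 1) (t Data.Nat.+ t))

{-# OPTIONS --safe #-}

-- The generating function F of p̄₋₁₁ satisfies F Θ¹¹ = 1 with Θ = (q;q)²/(q²;q²), and by Gauss
-- Θ = 1 + 2θ where θ = Σ_{s≥1} (−1)^s q^{s²}. Hence F ≡ Σ_{k≤5} C(−11,k) 2^k θ^k (mod 64).
-- Split θ = a + b into odd and even s: the exponents of a are 1 mod 8, those of b are 0 mod 4.
-- Hence at 8n+2 the term θ vanishes, at 8n+3 so does θ², and at 8n+7 so does θ³, while there
-- θ⁴ and θ⁵ contribute only through 4a³b and 10a³b².
--
-- Gauss's identity is obtained from Shanks' finite form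
--   Π_{i≤n} (1 + q^i) Σ_{|s|≤n} (−1)^s q^{s²}
--     = Σ_{s≤n} (−1)^s Π_{0≤i<s} (1 + q^i) Π_{s<i≤n} (1 − q^i) q^{s(n+1)},
-- whose right-hand side is Π_{i≤n} (1 − q^i) modulo q^{n+1}.
-- All computations take place in ℤ[[q]]/(q^{N+1}), where N is the index of the coefficient
-- of interest.
module Submission where

open import Defs
open import Algebra.Bundles using (CommutativeRing; RawRing)
import Algebra.Properties.CommutativeSemiring.Exp
import Algebra.Solver.Ring
open import Algebra.Solver.Ring.AlmostCommutativeRing using (fromCommutativeRing; _-Raw-AlmostCommutative⟶_)
open import Data.Empty using (⊥-elim)
open import Data.Integer as ℤ using (ℤ; +_)
open import Data.Integer.Divisibility using (_∣_)
open import Data.Integer.Divisibility.Signed as Signed using () renaming (_∣_ to _∣ₛ_)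
import Data.Integer.Properties as ℤ
open import Data.Integer.Solver using (module +-*-Solver)
open import Data.List using (_∷_; map; zipWith; upTo; applyUpTo; applyDownFrom)
open import Data.List.Properties using (map-upTo)
import Data.Maybe as Maybe
open import Data.Nat as ℕ using (ℕ; zero; suc; _∸_; _≤_; _<_; z≤n; s≤s; NonZero; _%_)
import Data.Nat.Divisibility as ℕ
open import Data.Nat.DivMod using (%-distribˡ-+; [m+kn]%n≡m%n; m∣n⇒o%n%m≡o%m)
import Data.Nat.Properties as ℕ
import Data.Nat.Tactic.RingSolver as ℕ-Solver
open import Data.Product using (_×_; _,_; Σ-syntax)
open import Data.Sum using (_⊎_; inj₁; inj₂)
open import Function using (_∘_)
open import Level using (0ℓ)
open import Relation.Binary.PropositionalEquality as ≡ using (_≡_; _≢_)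
import Relation.Binary.Reasoning.Setoid
open import Relation.Nullary using (yes; no)
open import Relation.Nullary.Decidable using (dec⇒maybe)

-- Laws of the Cauchy product.

module SeriesRing where

  open import Data.Integer using (-_; _+_; _*_)
  open ≡ using (refl; sym; trans; cong; cong₂)
  open ≡.≡-Reasoning

  infixl 16 _⊕_
  infix 17 ⊖_
  _⊕_ : Series → Series → Series
  (f ⊕ g) n = f n + g n

  ⊖_ : Series → Series
  (⊖ f) n = - f n

  -- The embedding of ℤ as constant series; it supplies the coefficients of the ring solver over the
  -- truncated ring.
  const : ℤ → Series
  const c zero    = c
  const c (suc _) = + 0

  sumTo-cong : ∀ n {f g} → (∀ {k} → k ≤ n → f k ≡ g k) → sumTo n f ≡ sumTo n g
  sumTo-cong zero    f≡g = f≡g z≤n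
  sumTo-cong (suc n) f≡g = cong₂ _+_ (sumTo-cong n (f≡g ∘ ℕ.m≤n⇒m≤1+n)) (f≡g ℕ.≤-refl)

  sumTo-zero : ∀ n {f} → (∀ {k} → k ≤ n → f k ≡ + 0) → sumTo n f ≡ + 0
  sumTo-zero zero    f≡0 = f≡0 z≤n
  sumTo-zero (suc n) f≡0 = cong₂ _+_ (sumTo-zero n (f≡0 ∘ ℕ.m≤n⇒m≤1+n)) (f≡0 ℕ.≤-refl)

  sumTo-suc : ∀ n f → sumTo (suc n) f ≡ f 0 + sumTo n (f ∘ suc)
  sumTo-suc zero    f = refl
  sumTo-suc (suc n) f = begin
    sumTo (suc n) f + f (suc (suc n))                ≡⟨ cong (_+ f (suc (suc n))) (sumTo-suc n f) ⟩
    f 0 + sumTo n (f ∘ suc) + f (suc (suc n))        ≡⟨ ℤ.+-assoc (f 0) _ _ ⟩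
    f 0 + sumTo (suc n) (f ∘ suc)                    ∎

  -- All laws of the Cauchy product are obtained from this recursion on the coefficient index.
  ⊛-suc : ∀ f g n → (f ⊛ g) (suc n) ≡ f 0 * g (suc n) + ((f ∘ suc) ⊛ g) n
  ⊛-suc f g n = sumTo-suc n _

  ⊛-cong≤ : ∀ {f f′ g g′} n → (∀ {k} → k ≤ n → f k ≡ f′ k) → (∀ {k} → k ≤ n → g k ≡ g′ k) →
            (f ⊛ g) n ≡ (f′ ⊛ g′) n
  ⊛-cong≤ n p q = sumTo-cong n λ {k} k≤n → cong₂ _*_ (p k≤n) (q (ℕ.m∸n≤m n k))

  -- Peeling off the first term of both factors leaves `f⁺ ⊛ g⁺` two indices lower, where the
  -- induction hypothesis swaps the factors; hence the two base cases.
  ⊛-comm : ∀ f g n → (f ⊛ g) n ≡ (g ⊛ f) n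
  ⊛-comm f g zero          = ℤ.*-comm (f 0) (g 0)
  ⊛-comm f g (suc zero)    =
    solve 4 (λ a b c d → a :* d :+ b :* c := c :* b :+ d :* a) refl (f 0) (f 1) (g 0) (g 1)
    where open +-*-Solver
  ⊛-comm f g (suc (suc n)) = begin
    (f ⊛ g) (suc (suc n))
      ≡⟨ ⊛-suc f g (suc n) ⟩
    f 0 * g (suc (suc n)) + (f⁺ ⊛ g) (suc n)
      ≡⟨ cong (λ x → f 0 * g (suc (suc n)) + x) (trans (⊛-comm f⁺ g (suc n)) (⊛-suc g f⁺ n)) ⟩
    f 0 * g (suc (suc n)) + (g 0 * f (suc (suc n)) + (g⁺ ⊛ f⁺) n)
      ≡⟨ cong (λ x → f 0 * g (suc (suc n)) + (g 0 * f (suc (suc n)) + x)) (⊛-comm g⁺ f⁺ n) ⟩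
    f 0 * g (suc (suc n)) + (g 0 * f (suc (suc n)) + (f⁺ ⊛ g⁺) n)
      ≡⟨ solve 3 (λ a b c → a :+ (b :+ c) := b :+ (a :+ c)) refl (f 0 * g (suc (suc n))) (g 0 * f (suc (suc n))) _ ⟩
    g 0 * f (suc (suc n)) + (f 0 * g (suc (suc n)) + (f⁺ ⊛ g⁺) n)
      ≡⟨ cong (λ x → g 0 * f (suc (suc n)) + x) (trans (⊛-comm g⁺ f (suc n)) (⊛-suc f g⁺ n)) ⟨
    g 0 * f (suc (suc n)) + (g⁺ ⊛ f) (suc n)
      ≡⟨ ⊛-suc g f (suc n) ⟨
    (g ⊛ f) (suc (suc n)) ∎
    where
    open +-*-Solver
    f⁺ = f ∘ suc
    g⁺ = g ∘ suc

  ⊛-distribʳ : ∀ h f g n → ((f ⊕ g) ⊛ h) n ≡ ((f ⊛ h) ⊕ (g ⊛ h)) n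
  ⊛-distribʳ h f g zero    = ℤ.*-distribʳ-+ (h 0) (f 0) (g 0)
  ⊛-distribʳ h f g (suc n) = begin
    ((f ⊕ g) ⊛ h) (suc n)
      ≡⟨ ⊛-suc (f ⊕ g) h n ⟩
    (f 0 + g 0) * h (suc n) + (((f ∘ suc) ⊕ (g ∘ suc)) ⊛ h) n
      ≡⟨ cong (λ x → (f 0 + g 0) * h (suc n) + x) (⊛-distribʳ h (f ∘ suc) (g ∘ suc) n) ⟩
    (f 0 + g 0) * h (suc n) + (((f ∘ suc) ⊛ h) n + ((g ∘ suc) ⊛ h) n)
      ≡⟨ solve 5 (λ a b c x y → (a :+ b) :* c :+ (x :+ y) := (a :* c :+ x) :+ (b :* c :+ y)) refl
           (f 0) (g 0) (h (suc n)) (((f ∘ suc) ⊛ h) n) (((g ∘ suc) ⊛ h) n) ⟩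
    (f 0 * h (suc n) + ((f ∘ suc) ⊛ h) n) + (g 0 * h (suc n) + ((g ∘ suc) ⊛ h) n)
      ≡⟨ cong₂ _+_ (⊛-suc f h n) (⊛-suc g h n) ⟨
    ((f ⊛ h) ⊕ (g ⊛ h)) (suc n) ∎
    where open +-*-Solver

  ⊛-scaleˡ : ∀ c f g n → ((λ k → c * f k) ⊛ g) n ≡ c * (f ⊛ g) n
  ⊛-scaleˡ c f g zero    = ℤ.*-assoc c (f 0) (g 0)
  ⊛-scaleˡ c f g (suc n) = begin
    sumTo n _ + c * f (suc n) * g (n ∸ n)         ≡⟨⟩
    ((λ k → c * f k) ⊛ g) (suc n)                 ≡⟨ ⊛-suc (λ k → c * f k) g n ⟩
    c * f 0 * g (suc n) + ((λ k → c * f (suc k)) ⊛ g) n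
      ≡⟨ cong₂ _+_ (ℤ.*-assoc c (f 0) _) (⊛-scaleˡ c (f ∘ suc) g n) ⟩
    c * (f 0 * g (suc n)) + c * ((f ∘ suc) ⊛ g) n ≡⟨ ℤ.*-distribˡ-+ c _ _ ⟨
    c * (f 0 * g (suc n) + ((f ∘ suc) ⊛ g) n)     ≡⟨ cong (c *_) (⊛-suc f g n) ⟨
    c * (f ⊛ g) (suc n)                           ∎

  ⊛-assoc : ∀ f g h n → ((f ⊛ g) ⊛ h) n ≡ (f ⊛ (g ⊛ h)) n
  ⊛-assoc f g h zero    = ℤ.*-assoc (f 0) (g 0) (h 0)
  ⊛-assoc f g h (suc n) = begin
    ((f ⊛ g) ⊛ h) (suc n)
      ≡⟨ ⊛-suc (f ⊛ g) h n ⟩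
    f 0 * g 0 * h (suc n) + (((f ⊛ g) ∘ suc) ⊛ h) n
      ≡⟨ cong (λ x → f 0 * g 0 * h (suc n) + x) (⊛-cong≤ n (λ {k} _ → ⊛-suc f g k) (λ {k} _ → refl {x = h k})) ⟩
    f 0 * g 0 * h (suc n) + (((λ k → f 0 * g (suc k)) ⊕ (f⁺ ⊛ g)) ⊛ h) n
      ≡⟨ cong (λ x → f 0 * g 0 * h (suc n) + x) (⊛-distribʳ h (λ k → f 0 * g (suc k)) (f⁺ ⊛ g) n) ⟩
    f 0 * g 0 * h (suc n) + (((λ k → f 0 * g (suc k)) ⊛ h) n + ((f⁺ ⊛ g) ⊛ h) n)
      ≡⟨ cong (λ x → f 0 * g 0 * h (suc n) + x) (cong₂ _+_ (⊛-scaleˡ (f 0) (g ∘ suc) h n) (⊛-assoc f⁺ g h n)) ⟩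
    f 0 * g 0 * h (suc n) + (f 0 * ((g ∘ suc) ⊛ h) n + (f⁺ ⊛ (g ⊛ h)) n)
      ≡⟨ solve 5 (λ a b c x y → a :* b :* c :+ (a :* x :+ y) := a :* (b :* c :+ x) :+ y) refl
           (f 0) (g 0) (h (suc n)) (((g ∘ suc) ⊛ h) n) ((f⁺ ⊛ (g ⊛ h)) n) ⟩
    f 0 * (g 0 * h (suc n) + ((g ∘ suc) ⊛ h) n) + (f⁺ ⊛ (g ⊛ h)) n
      ≡⟨ cong (λ x → f 0 * x + (f⁺ ⊛ (g ⊛ h)) n) (⊛-suc g h n) ⟨
    f 0 * (g ⊛ h) (suc n) + (f⁺ ⊛ (g ⊛ h)) n
      ≡⟨ ⊛-suc f (g ⊛ h) n ⟨
    (f ⊛ (g ⊛ h)) (suc n) ∎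
    where
    open +-*-Solver
    f⁺ = f ∘ suc

  const-⊛ : ∀ c f n → (const c ⊛ f) n ≡ c * f n
  const-⊛ c f zero    = refl
  const-⊛ c f (suc n) = begin
    (const c ⊛ f) (suc n)                 ≡⟨ ⊛-suc (const c) f n ⟩
    c * f (suc n) + ((λ _ → + 0) ⊛ f) n   ≡⟨ cong (λ x → c * f (suc n) + x) (sumTo-zero n λ _ → refl) ⟩
    c * f (suc n) + + 0                   ≡⟨ ℤ.+-identityʳ _ ⟩
    c * f (suc n)                         ∎

  const-1 : ∀ n → const (+ 1) n ≡ oneS n
  const-1 zero    = refl
  const-1 (suc n) = refl

  const-+ : ∀ a b n → const (a + b) n ≡ (const a ⊕ const b) n
  const-+ a b zero    = refl
  const-+ a b (suc n) = refl

  const-* : ∀ a b n → const (a * b) n ≡ (const a ⊛ const b) n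
  const-* a b zero    = refl
  const-* a b (suc n) = sym (trans (const-⊛ a (const b) (suc n)) (ℤ.*-zeroʳ a))

  const-neg : ∀ a n → const (- a) n ≡ (⊖ const a) n
  const-neg a zero    = refl
  const-neg a (suc n) = refl

  ⊛-identityˡ : ∀ f n → (oneS ⊛ f) n ≡ f n
  ⊛-identityˡ f n = begin
    (oneS ⊛ f) n          ≡⟨ ⊛-cong≤ {g = f} n (λ {k} _ → const-1 k) (λ _ → refl) ⟨
    (const (+ 1) ⊛ f) n   ≡⟨ const-⊛ (+ 1) f n ⟩
    + 1 * f n             ≡⟨ ℤ.*-identityˡ (f n) ⟩
    f n                   ∎

  -- Monomials and the infinite products.

  mono : ℕ → Series
  mono zero             = oneS
  mono (suc m) zero     = + 0
  mono (suc m) (suc n)  = mono m n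

  mono-off : ∀ {m n} → m ≢ n → mono m n ≡ + 0
  mono-off {zero}  {zero}  m≢n with () ← m≢n refl
  mono-off {zero}  {suc n} m≢n = refl
  mono-off {suc m} {zero}  m≢n = refl
  mono-off {suc m} {suc n} m≢n = mono-off (m≢n ∘ cong suc)

  mono-+ : ∀ i j n → mono (i ℕ.+ j) n ≡ (mono i ⊛ mono j) n
  mono-+ zero    j n       = sym (⊛-identityˡ (mono j) n)
  mono-+ (suc i) j zero    = refl
  mono-+ (suc i) j (suc n) = begin
    mono (i ℕ.+ j) n                      ≡⟨ mono-+ i j n ⟩
    (mono i ⊛ mono j) n                   ≡⟨ ℤ.+-identityˡ _ ⟨
    + 0 + (mono i ⊛ mono j) n             ≡⟨ ⊛-suc (mono (suc i)) (mono j) n ⟨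
    (mono (suc i) ⊛ mono j) (suc n)       ∎

  oneMinusQ≡1-mono : ∀ m n → oneMinusQ (suc m) n ≡ (oneS ⊕ ⊖ mono (suc m)) n
  oneMinusQ≡1-mono m       zero          = refl
  oneMinusQ≡1-mono zero    (suc zero)    = refl
  oneMinusQ≡1-mono zero    (suc (suc n)) = refl
  oneMinusQ≡1-mono (suc m) (suc zero)    = refl
  oneMinusQ≡1-mono (suc m) (suc (suc n)) = oneMinusQ≡1-mono m (suc n)

  -- A further factor is `1 - q^m` with `m = suc d * suc k > n`, so it agrees with 1 on all
  -- coefficients up to `n`.
  finPoch-stable : ∀ d {n k} → n ≤ k → finPoch (suc d) k n ≡ poch (suc d) n
  finPoch-stable d {zero}  {zero}  z≤n = refl
  finPoch-stable d {n}     {suc k} n≤1+k with ℕ.m≤n⇒m<n∨m≡n n≤1+k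
  ... | inj₂ refl = refl
  ... | inj₁ (s≤s n≤k) = begin
    (finPoch (suc d) k ⊛ oneMinusQ (suc d ℕ.* suc k)) n
      ≡⟨ ⊛-cong≤ {f = finPoch (suc d) k} n (λ _ → refl) low ⟩
    (finPoch (suc d) k ⊛ oneS) n  ≡⟨ ⊛-comm (finPoch (suc d) k) oneS n ⟩
    (oneS ⊛ finPoch (suc d) k) n  ≡⟨ ⊛-identityˡ (finPoch (suc d) k) n ⟩
    finPoch (suc d) k n           ≡⟨ finPoch-stable d n≤k ⟩
    poch (suc d) n                ∎
    where
    low : ∀ {j} → j ≤ n → oneMinusQ (suc d ℕ.* suc k) j ≡ oneS j
    low {j} j≤n = trans (oneMinusQ≡1-mono (k ℕ.+ d ℕ.* suc k) j)
      (trans (cong (λ x → oneS j + - x) (mono-off {suc d ℕ.* suc k} (ℕ.>⇒≢ j<))) (ℤ.+-identityʳ _))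
      where
      j< : j < suc d ℕ.* suc k
      j< = ℕ.≤-trans (s≤s (ℕ.≤-trans j≤n n≤k)) (ℕ.m≤m+n (suc k) (d ℕ.* suc k))

  -- Multiplicative inverses.

  invList≡applyDownFrom : ∀ a n → invList a n ≡ applyDownFrom (invS a) (suc n)
  invList≡applyDownFrom a zero    = refl
  invList≡applyDownFrom a (suc n) = cong (invS a (suc n) ∷_) (invList≡applyDownFrom a n)

  -- Pairing one list in ascending order with another in descending order is the Cauchy product;
  -- this reads the list recursion behind `invS` as an identity of series.
  sum-zipWith≡⊛ : ∀ f g n → sumℤ (zipWith _*_ (applyUpTo f (suc n)) (applyDownFrom g (suc n))) ≡ (f ⊛ g) n
  sum-zipWith≡⊛ f g zero    = ℤ.+-identityʳ (f 0 * g 0)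
  sum-zipWith≡⊛ f g (suc n) = begin
    f 0 * g (suc n) + sumℤ (zipWith _*_ (applyUpTo (f ∘ suc) (suc n)) (applyDownFrom g (suc n)))
      ≡⟨ cong (λ x → f 0 * g (suc n) + x) (sum-zipWith≡⊛ (f ∘ suc) g n) ⟩
    f 0 * g (suc n) + ((f ∘ suc) ⊛ g) n
      ≡⟨ ⊛-suc f g n ⟨
    (f ⊛ g) (suc n) ∎

  invS-suc : ∀ a n → invS a (suc n) ≡ - ((a ∘ suc) ⊛ invS a) n
  invS-suc a n = cong -_ (begin
    sumℤ (zipWith _*_ (map (a ∘ suc) (upTo (suc n))) (invList a n))
      ≡⟨ cong₂ (λ xs ys → sumℤ (zipWith _*_ xs ys)) (map-upTo (a ∘ suc) (suc n)) (invList≡applyDownFrom a n) ⟩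
    sumℤ (zipWith _*_ (applyUpTo (a ∘ suc) (suc n)) (applyDownFrom (invS a) (suc n)))
      ≡⟨ sum-zipWith≡⊛ (a ∘ suc) (invS a) n ⟩
    ((a ∘ suc) ⊛ invS a) n ∎)

  ⊛-invS : ∀ a → a 0 ≡ + 1 → ∀ n → (a ⊛ invS a) n ≡ oneS n
  ⊛-invS a a₀≡1 zero    = cong (_* + 1) a₀≡1
  ⊛-invS a a₀≡1 (suc n) = begin
    (a ⊛ invS a) (suc n)
      ≡⟨ ⊛-suc a (invS a) n ⟩
    a 0 * invS a (suc n) + ((a ∘ suc) ⊛ invS a) n
      ≡⟨ cong (_+ ((a ∘ suc) ⊛ invS a) n) (cong₂ _*_ a₀≡1 (invS-suc a n)) ⟩
    + 1 * - ((a ∘ suc) ⊛ invS a) n + ((a ∘ suc) ⊛ invS a) n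
      ≡⟨ cong (_+ ((a ∘ suc) ⊛ invS a) n) (ℤ.*-identityˡ (- ((a ∘ suc) ⊛ invS a) n)) ⟩
    - ((a ∘ suc) ⊛ invS a) n + ((a ∘ suc) ⊛ invS a) n
      ≡⟨ ℤ.+-inverseˡ (((a ∘ suc) ⊛ invS a) n) ⟩
    + 0 ∎

  -- The ring ℤ[[q]]/(q^(N+1)).

  infix 4 _≈[_]_
  record _≈[_]_ (f : Series) (N : ℕ) (g : Series) : Set where
    constructor coeffs
    field coeff : ∀ {k} → k ≤ N → f k ≡ g k
  open _≈[_]_ public

  exact : ∀ {N f g} → (∀ n → f n ≡ g n) → f ≈[ N ] g
  exact f≡g = coeffs λ {k} _ → f≡g k

  truncatedRing : ℕ → CommutativeRing 0ℓ 0ℓ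
  truncatedRing N = record
    { Carrier = Series
    ; _≈_     = _≈[ N ]_
    ; _+_     = _⊕_
    ; _*_     = _⊛_
    ; -_      = ⊖_
    ; 0#      = λ _ → + 0
    ; 1#      = oneS
    ; isCommutativeRing = record
      { isRing = record
        { +-isAbelianGroup = record
          { isGroup = record
            { isMonoid = record
              { isSemigroup = record
                { isMagma = record
                  { isEquivalence = record
                    { refl  = coeffs λ _ → refl
                    ; sym   = λ p → coeffs λ k≤N → sym (coeff p k≤N)
                    ; trans = λ p q → coeffs λ k≤N → trans (coeff p k≤N) (coeff q k≤N)
                    }
                  ; ∙-cong = λ p q → coeffs λ k≤N → cong₂ _+_ (coeff p k≤N) (coeff q k≤N)
                  }
                ; assoc = λ f g h → exact λ n → ℤ.+-assoc (f n) (g n) (h n)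
                }
              ; identity = (λ f → exact λ n → ℤ.+-identityˡ (f n)) , (λ f → exact λ n → ℤ.+-identityʳ (f n))
              }
            ; inverse = (λ f → exact λ n → ℤ.+-inverseˡ (f n)) , (λ f → exact λ n → ℤ.+-inverseʳ (f n))
            ; ⁻¹-cong = λ p → coeffs λ k≤N → cong -_ (coeff p k≤N)
            }
          ; comm = λ f g → exact λ n → ℤ.+-comm (f n) (g n)
          }
        ; *-cong = λ p q → coeffs λ {k} k≤N →
            ⊛-cong≤ k (λ j≤k → coeff p (ℕ.≤-trans j≤k k≤N)) (λ j≤k → coeff q (ℕ.≤-trans j≤k k≤N))
        ; *-assoc = λ f g h → exact (⊛-assoc f g h)
        ; *-identity = (λ f → exact (⊛-identityˡ f))
                     , (λ f → exact λ n → trans (⊛-comm f oneS n) (⊛-identityˡ f n))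
        ; distrib = (λ h f g → exact λ n →
                      trans (⊛-comm h (f ⊕ g) n) (trans (⊛-distribʳ h f g n)
                        (cong₂ _+_ (⊛-comm f h n) (⊛-comm g h n))))
                  , (λ h f g → exact (⊛-distribʳ h f g))
        }
      ; *-comm = λ f g → exact (⊛-comm f g)
      }
    }

  ℤ-rawRing : RawRing 0ℓ 0ℓ
  ℤ-rawRing = CommutativeRing.rawRing ℤ.+-*-commutativeRing

  const-morphism : ∀ N → ℤ-rawRing -Raw-AlmostCommutative⟶ fromCommutativeRing (truncatedRing N)
  const-morphism N = record
    { ⟦_⟧    = const
    ; +-homo = λ a b → exact (const-+ a b)
    ; *-homo = λ a b → exact (const-* a b)
    ; -‿homo = λ a → exact (const-neg a)
    ; 0-homo = exact λ { zero → refl ; (suc _) → refl }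
    ; 1-homo = exact const-1
    }

open SeriesRing

-- Gauss's identity from Shanks' finite form, over an abstract commutative ring.

module Gauss {c ℓ} (R : CommutativeRing c ℓ)
             (morphism : ℤ-rawRing -Raw-AlmostCommutative⟶ fromCommutativeRing R) where

  open CommutativeRing R hiding (zero)
  open _-Raw-AlmostCommutative⟶_ morphism using (⟦_⟧; 1-homo)
  open Algebra.Properties.CommutativeSemiring.Exp commutativeSemiring
  open Relation.Binary.Reasoning.Setoid setoid

  module Solver = Algebra.Solver.Ring ℤ-rawRing (fromCommutativeRing R) morphism
    (λ a b → Maybe.map (λ a≡b → reflexive (≡.cong ⟦_⟧ a≡b)) (dec⇒maybe (a ℤ.≟ b)))
  open Solver using (solve; con; _:=_; _:+_; _:-_; _:*_; :-_; _:^_)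

  -- Not 1#, which the solver's constant con (+ 1) does not evaluate to definitionally.
  one : Carrier
  one = ⟦ + 1 ⟧

  *-one : ∀ x → x * one ≈ x
  *-one x = trans (*-congˡ 1-homo) (*-identityʳ x)

  -- `E i` stands for `q^i`.
  module Theta (E : ℕ → Carrier) (E-0 : E 0 ≈ one) (E-+ : ∀ i j → E (i ℕ.+ j) ≈ E i * E j) where

    sign : ℕ → Carrier
    sign zero    = one
    sign (suc n) = - sign n

    -- (Σ_{0<|s|≤n} (−1)^s q^{s²}) / 2
    halfTheta : ℕ → Carrier
    halfTheta zero    = ⟦ + 0 ⟧
    halfTheta (suc n) = halfTheta n + sign (suc n) * E (suc n ℕ.* suc n)

    theta : ℕ → Carrier
    theta n = one + ⟦ + 2 ⟧ * halfTheta n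

    -- Π_{s<i≤s+d} (1 − q^i)
    minusProd : ℕ → ℕ → Carrier
    minusProd s zero    = one
    minusProd s (suc d) = minusProd s d * (one - E (s ℕ.+ suc d))

    plusProd : ℕ → Carrier
    plusProd zero    = one
    plusProd (suc n) = plusProd n * (one + E (suc n))

    minusProd² : ℕ → Carrier
    minusProd² zero    = one
    minusProd² (suc n) = minusProd² n * (one - E (2 ℕ.* suc n))

    -- (−1)^s Π_{0≤i<s} (1 + q^i); the factor i = 0 supplies the 2 of 1 + 2 Σ_{s>0} (−1)^s q^{s²}.
    weight : ℕ → Carrier
    weight zero    = one
    weight (suc s) = - (weight s * (one + E s))

    summand : ℕ → ℕ → Carrier
    summand n s = weight s * minusProd s (n ∸ s) * E (s ℕ.* suc n)

    partialSum : ℕ → ℕ → Carrier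
    partialSum n zero    = summand n 0
    partialSum n (suc s) = partialSum n s + summand n (suc s)

    -- The definition splits off the top factor; the telescoping in `s` also needs the bottom one.
    minusProd-suc : ∀ s d → minusProd s (suc d) ≈ (one - E (suc s)) * minusProd (suc s) d
    minusProd-suc s zero = begin
      one * (one - E (s ℕ.+ 1))   ≈⟨ *-comm _ _ ⟩
      (one - E (s ℕ.+ 1)) * one   ≡⟨ ≡.cong (λ i → (one - E i) * one) (ℕ.+-comm s 1) ⟩
      (one - E (suc s)) * one     ∎
    minusProd-suc s (suc d) = begin
      minusProd s (suc d) * (one - E (s ℕ.+ suc (suc d)))
        ≡⟨ ≡.cong (λ i → minusProd s (suc d) * (one - E i)) (ℕ.+-suc s (suc d)) ⟩
      minusProd s (suc d) * (one - E (suc s ℕ.+ suc d))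
        ≈⟨ *-congʳ (minusProd-suc s d) ⟩
      (one - E (suc s)) * minusProd (suc s) d * (one - E (suc s ℕ.+ suc d))
        ≈⟨ *-assoc _ _ _ ⟩
      (one - E (suc s)) * minusProd (suc s) (suc d) ∎

    -- Brings the weights into the shape of the increments of `plusProd n * theta n`.
    weight-suc : ∀ s → weight (suc s) ≈ ⟦ + 2 ⟧ * (sign (suc s) * plusProd s)
    weight-suc zero = begin
      - (one * (one + E 0))             ≈⟨ -‿cong (*-congˡ (+-congˡ E-0)) ⟩
      - (one * (one + one))             ≈⟨ solve 0 (:- (con (+ 1) :* (con (+ 1) :+ con (+ 1))) := con (+ 2) :* ((:- con (+ 1)) :* con (+ 1))) refl ⟩
      ⟦ + 2 ⟧ * (- one * one)           ∎
    weight-suc (suc s) = begin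
      - (weight (suc s) * (one + E (suc s)))
        ≈⟨ -‿cong (*-congʳ (weight-suc s)) ⟩
      - (⟦ + 2 ⟧ * (sign (suc s) * plusProd s) * (one + E (suc s)))
        ≈⟨ solve 3 (λ σ p x → :- (con (+ 2) :* (σ :* p) :* (con (+ 1) :+ x)) := con (+ 2) :* ((:- σ) :* (p :* (con (+ 1) :+ x)))) refl
             (sign (suc s)) (plusProd s) (E (suc s)) ⟩
      ⟦ + 2 ⟧ * (sign (suc (suc s)) * plusProd (suc s)) ∎

    E-*-suc : ∀ m n → E (m ℕ.* suc n) ≈ E m * E (m ℕ.* n)
    E-*-suc m n = trans (reflexive (≡.cong E (ℕ.*-suc m n))) (E-+ m (m ℕ.* n))

    -- The summands of partialSum (n+1) s − (1 + q^(n+1)) partialSum n s telescope in s.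
    partialSum-suc : ∀ n s → s ≤ n → partialSum (suc n) s ≈
      (one + E (suc n)) * partialSum n s + weight (suc s) * E (suc s ℕ.* suc n) * minusProd s (n ∸ s)
    partialSum-suc n zero z≤n = begin
      one * (minusProd 0 n * (one - E (suc n))) * E 0
        ≈⟨ *-congˡ E-0 ⟩
      one * (minusProd 0 n * (one - E (suc n))) * one
        ≈⟨ solve 2 (λ p x →
             con (+ 1) :* (p :* (con (+ 1) :- x)) :* con (+ 1) :=
             (con (+ 1) :+ x) :* (con (+ 1) :* p :* con (+ 1)) :+
             (:- (con (+ 1) :* (con (+ 1) :+ con (+ 1)))) :* x :* p) refl (minusProd 0 n) (E (suc n)) ⟩
      (one + E (suc n)) * (one * minusProd 0 n * one) + - (one * (one + one)) * E (suc n) * minusProd 0 n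
        ≈⟨ +-cong (*-congˡ (*-congˡ E-0))
             (*-congʳ (*-cong (-‿cong (*-congˡ (+-congˡ E-0))) (reflexive (≡.cong E (ℕ.+-identityʳ (suc n)))))) ⟨
      (one + E (suc n)) * partialSum n 0 + weight 1 * E (1 ℕ.* suc n) * minusProd 0 n ∎
    partialSum-suc n (suc s) s<n = begin
      partialSum (suc n) s + v * minusProd (suc s) (n ∸ s) * E (suc s ℕ.* suc (suc n))
        ≈⟨ +-cong (partialSum-suc n s (ℕ.<⇒≤ s<n)) (*-congˡ (E-*-suc (suc s) (suc n))) ⟩
      (one + x) * p + v * y * minusProd s (n ∸ s) + v * minusProd (suc s) (n ∸ s) * (z * y)
        ≡⟨ ≡.cong (λ i → (one + x) * p + v * y * minusProd s i + v * minusProd (suc s) i * (z * y)) n∸s≡1+d ⟩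
      (one + x) * p + v * y * minusProd s (suc d) + v * (π * (one - E (suc s ℕ.+ suc d))) * (z * y)
        ≡⟨ ≡.cong (λ i → (one + x) * p + v * y * minusProd s (suc d) + v * (π * (one - E i)) * (z * y)) 1+s+1+d≡1+n ⟩
      (one + x) * p + v * y * minusProd s (suc d) + v * (π * (one - x)) * (z * y)
        ≈⟨ +-congʳ (+-congˡ (*-congˡ (minusProd-suc s d))) ⟩
      (one + x) * p + v * y * ((one - z) * π) + v * (π * (one - x)) * (z * y)
        -- Apart from `(one + x) * p`, both sides equal `v * y * π * (one - x * z)`.
        ≈⟨ solve 6 (λ p v y z x π →
             (con (+ 1) :+ x) :* p :+ v :* y :* ((con (+ 1) :- z) :* π) :+ v :* (π :* (con (+ 1) :- x)) :* (z :* y) :=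
             (con (+ 1) :+ x) :* (p :+ v :* π :* y) :+ (:- (v :* (con (+ 1) :+ z))) :* (x :* y) :* π) refl p v y z x π ⟩
      (one + x) * (p + v * π * y) + - (v * (one + z)) * (x * y) * π
        ≈⟨ +-congˡ (*-congʳ (*-congˡ (E-+ (suc n) (suc s ℕ.* suc n)))) ⟨
      (one + x) * partialSum n (suc s) + weight (suc (suc s)) * E (suc (suc s) ℕ.* suc n) * π ∎
      where
      d = n ∸ suc s
      v = weight (suc s)
      x = E (suc n)
      y = E (suc s ℕ.* suc n)
      z = E (suc s)
      p = partialSum n s
      π = minusProd (suc s) d
      n∸s≡1+d : n ∸ s ≡ suc d
      n∸s≡1+d = ℕ.+-∸-assoc 1 s<n
      1+s+1+d≡1+n : suc s ℕ.+ suc d ≡ suc n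
      1+s+1+d≡1+n = ≡.trans (ℕ.+-suc (suc s) d) (≡.cong suc (ℕ.m+[n∸m]≡n s<n))

    -- Shanks' identity, by induction on `n`. The new term of `theta` contributes `2σbe(1 + x)`: the
    -- part with `e` is the boundary term that `partialSum-suc` leaves at `s = n`, and the part with
    -- `xe` is the new summand `s = n + 1`.
    plusProd*theta : ∀ n → plusProd n * theta n ≈ partialSum n n
    plusProd*theta zero = begin
      one * (one + ⟦ + 2 ⟧ * ⟦ + 0 ⟧)
        ≈⟨ solve 0 (con (+ 1) :* (con (+ 1) :+ con (+ 2) :* con (+ 0)) := con (+ 1) :* con (+ 1) :* con (+ 1)) refl ⟩
      one * one * one   ≈⟨ *-congˡ E-0 ⟨
      one * one * E 0   ∎
    plusProd*theta (suc n) = begin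
      b * (one + x) * (one + ⟦ + 2 ⟧ * (h + σ * e))
        ≈⟨ solve 5 (λ b x h σ e →
             b :* (con (+ 1) :+ x) :* (con (+ 1) :+ con (+ 2) :* (h :+ σ :* e)) :=
             (con (+ 1) :+ x) :* (b :* (con (+ 1) :+ con (+ 2) :* h)) :+
             con (+ 2) :* (σ :* b) :* e :* con (+ 1) :+ con (+ 2) :* (σ :* b) :* con (+ 1) :* (x :* e)) refl b x h σ e ⟩
      (one + x) * (b * theta n) + ⟦ + 2 ⟧ * (σ * b) * e * one + ⟦ + 2 ⟧ * (σ * b) * one * (x * e)
        ≈⟨ +-cong (+-cong (*-congˡ (plusProd*theta n)) (*-congʳ (*-congʳ (sym (weight-suc n)))))
             (*-cong (*-congʳ (sym (weight-suc n))) (sym (E-*-suc (suc n) (suc n)))) ⟩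
      (one + x) * partialSum n n + v * e * one + v * one * E (suc n ℕ.* suc (suc n))
        ≡⟨ ≡.cong (λ i → (one + x) * partialSum n n + v * e * minusProd n i + v * minusProd (suc n) i * E (suc n ℕ.* suc (suc n)))
             (ℕ.n∸n≡0 n) ⟨
      (one + x) * partialSum n n + v * e * minusProd n (n ∸ n) + summand (suc n) (suc n)
        ≈⟨ +-congʳ (partialSum-suc n n ℕ.≤-refl) ⟨
      partialSum (suc n) (suc n) ∎
      where
      b = plusProd n
      x = E (suc n)
      h = halfTheta n
      σ = sign (suc n)
      e = E (suc n ℕ.* suc n)
      v = weight (suc n)

    -- Factor by factor, `1 - q^(2i) = (1 - q^i)(1 + q^i)`.
    minusProd²≈ : ∀ k → minusProd² k ≈ minusProd 0 k * plusProd k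
    minusProd²≈ zero    = sym (*-one one)
    minusProd²≈ (suc k) = begin
      minusProd² k * (one - E (2 ℕ.* suc k))
        ≈⟨ *-cong (minusProd²≈ k) (+-congˡ (-‿cong (trans (E-+ (suc k) (suc k ℕ.+ 0)) (*-congˡ (reflexive (≡.cong E (ℕ.+-identityʳ (suc k)))))))) ⟩
      minusProd 0 k * plusProd k * (one - E (suc k) * E (suc k))
        ≈⟨ solve 3 (λ a b x → a :* b :* (con (+ 1) :- x :* x) := a :* (con (+ 1) :- x) :* (b :* (con (+ 1) :+ x))) refl
             (minusProd 0 k) (plusProd k) (E (suc k)) ⟩
      minusProd 0 (suc k) * plusProd (suc k) ∎

    module _ {n} (E-vanishes : ∀ {k} → n < k → E k ≈ 0#) where

      -- Every summand with `s ≥ 1` carries `q^(s(n+1))`, which is zero after truncation; only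
      -- `s = 0` survives.
      partialSum≈minusProd : ∀ s → partialSum n s ≈ minusProd 0 n
      partialSum≈minusProd zero = begin
        one * minusProd 0 n * E 0   ≈⟨ *-congˡ E-0 ⟩
        one * minusProd 0 n * one   ≈⟨ solve 1 (λ p → con (+ 1) :* p :* con (+ 1) := p) refl (minusProd 0 n) ⟩
        minusProd 0 n               ∎
      partialSum≈minusProd (suc s) = begin
        partialSum n s + w * E (suc s ℕ.* suc n)
          ≈⟨ +-cong (partialSum≈minusProd s) (*-congˡ (E-vanishes (ℕ.m≤m+n (suc n) (s ℕ.* suc n)))) ⟩
        minusProd 0 n + w * 0#    ≈⟨ +-congˡ (zeroʳ w) ⟩
        minusProd 0 n + 0#        ≈⟨ +-identityʳ _ ⟩
        minusProd 0 n             ∎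
        where w = weight (suc s) * minusProd (suc s) (n ∸ suc s)

      minusProd²*theta : minusProd² n * theta n ≈ minusProd 0 n * minusProd 0 n
      minusProd²*theta = begin
        minusProd² n * theta n                     ≈⟨ *-congʳ (minusProd²≈ n) ⟩
        minusProd 0 n * plusProd n * theta n       ≈⟨ *-assoc _ _ _ ⟩
        minusProd 0 n * (plusProd n * theta n)     ≈⟨ *-congˡ (plusProd*theta n) ⟩
        minusProd 0 n * partialSum n n             ≈⟨ *-congˡ (partialSum≈minusProd n) ⟩
        minusProd 0 n * minusProd 0 n              ∎

  -- Inverting the eleventh power of `1 + 2t` modulo 64.

  quotient-power : ∀ {a b j u} m → b * u ≈ a * a → a ^ (m ℕ.+ m) * j ≈ 1# → b ^ m * j * u ^ m ≈ 1#
  quotient-power {a} {b} {j} {u} m bu≈aa aj≈1 = begin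
    b ^ m * j * u ^ m       ≈⟨ solve 3 (λ x y z → x :* y :* z := x :* z :* y) refl (b ^ m) j (u ^ m) ⟩
    b ^ m * u ^ m * j       ≈⟨ *-congʳ (^-distrib-* b u m) ⟨
    (b * u) ^ m * j         ≈⟨ *-congʳ (^-congˡ m bu≈aa) ⟩
    (a * a) ^ m * j         ≈⟨ *-congʳ (^-distrib-* a a m) ⟩
    a ^ m * a ^ m * j       ≈⟨ *-congʳ (^-homo-* a m m) ⟨
    a ^ (m ℕ.+ m) * j       ≈⟨ aj≈1 ⟩
    1#                      ∎

  module _ (t : Carrier) where

    -- (1 − (1 + 2t)^11 head) / 64
    tail : Carrier
    tail = t ^ 6 * (⟦ + 8008 ⟧ + t * (⟦ + 137280 ⟧ + t * (⟦ + 1081080 ⟧ + t * (⟦ + 5125120 ⟧ + t * (⟦ + 16144128 ⟧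
      + t * (⟦ + 35223552 ⟧ + t * (⟦ + 53813760 ⟧ + t * (⟦ + 56770560 ⟧ + t * (⟦ + 39536640 ⟧ + t * (⟦ + 16400384 ⟧
      + t * ⟦ + 3075072 ⟧))))))))))

    -- (1 + 2t)^(−11) to order t⁵: the coefficients are 2^k C(−11, k).
    head : Carrier
    head = one - ⟦ + 22 ⟧ * t + ⟦ + 264 ⟧ * t ^ 2 - ⟦ + 2288 ⟧ * t ^ 3 + ⟦ + 16016 ⟧ * t ^ 4 - ⟦ + 96096 ⟧ * t ^ 5

    -- The product of `head` with the eleventh power is a polynomial in `2t` that agrees with 1
    -- below degree 6, so each remaining coefficient is divisible by 2^6. This makes the congruence
    -- an exact polynomial identity, checked by the solver.
    head-tail : (one + ⟦ + 2 ⟧ * t) ^ 11 * head + ⟦ + 64 ⟧ * tail ≈ one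
    head-tail = solve 1 (λ t →
      (con (+ 1) :+ con (+ 2) :* t) :^ 11 :*
      (con (+ 1) :- con (+ 22) :* t :+ con (+ 264) :* t :^ 2 :- con (+ 2288) :* t :^ 3 :+ con (+ 16016) :* t :^ 4 :- con (+ 96096) :* t :^ 5)
      :+ con (+ 64) :* (t :^ 6 :* (con (+ 8008) :+ t :* (con (+ 137280) :+ t :* (con (+ 1081080) :+ t :* (con (+ 5125120) :+ t :* (con (+ 16144128)
      :+ t :* (con (+ 35223552) :+ t :* (con (+ 53813760) :+ t :* (con (+ 56770560) :+ t :* (con (+ 39536640) :+ t :* (con (+ 16400384)
      :+ t :* con (+ 3075072)))))))))))) := con (+ 1)) refl t

    inverse-expansion : ∀ f → f * (one + ⟦ + 2 ⟧ * t) ^ 11 ≈ 1# → f ≈ head + ⟦ + 64 ⟧ * (f * tail)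
    inverse-expansion f fu≈1 = begin
      f                                     ≈⟨ *-one f ⟨
      f * one                               ≈⟨ *-congˡ head-tail ⟨
      f * (u * head + ⟦ + 64 ⟧ * tail)      ≈⟨ solve 4 (λ f u h r → f :* (u :* h :+ con (+ 64) :* r) := f :* u :* h :+ con (+ 64) :* (f :* r)) refl f u head tail ⟩
      f * u * head + ⟦ + 64 ⟧ * (f * tail)  ≈⟨ +-congʳ (trans (*-congʳ fu≈1) (*-identityˡ head)) ⟩
      head + ⟦ + 64 ⟧ * (f * tail)          ∎
      where u = (one + ⟦ + 2 ⟧ * t) ^ 11

-- Series supported on one residue class.

record Supported (m r : ℕ) .{{_ : NonZero m}} (f : Series) : Set where
  constructor supported
  field off-support : ∀ {n} → n % m ≢ r % m → f n ≡ + 0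
open Supported

module _ {m} .{{_ : NonZero m}} where

  const-supported : ∀ c → Supported m 0 (const c)
  const-supported c = supported λ
    { {zero}  n≢0 → ⊥-elim (n≢0 ≡.refl)
    ; {suc _} n≢0 → ≡.refl
    }

  mono-supported : ∀ k → Supported m k (mono k)
  mono-supported k = supported λ n≢k → mono-off (λ k≡n → n≢k (≡.cong (_% m) (≡.sym k≡n)))

  oneS-supported : Supported m 0 oneS
  oneS-supported = mono-supported 0

  ⊕-supported : ∀ {r f g} → Supported m r f → Supported m r g → Supported m r (f ⊕ g)
  ⊕-supported p q = supported λ n≢r → ≡.cong₂ ℤ._+_ (off-support p n≢r) (off-support q n≢r)

  ⊖-supported : ∀ {r f} → Supported m r f → Supported m r (⊖ f)
  ⊖-supported p = supported λ n≢r → ≡.cong ℤ.-_ (off-support p n≢r)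

  -- A nonzero term `f k * g (n ∸ k)` has `k` in the class of `r` and `n ∸ k` in that of `s`, which
  -- forces `n` into the class of `r + s`.
  ⊛-supported : ∀ {r s f g} → Supported m r f → Supported m s g → Supported m (r ℕ.+ s) (f ⊛ g)
  ⊛-supported {r} {s} {f} {g} p q = supported λ {n} n≢r+s → sumTo-zero n (term n≢r+s)
    where
    open ≡.≡-Reasoning
    term : ∀ {n k} → n % m ≢ (r ℕ.+ s) % m → k ≤ n → f k ℤ.* g (n ∸ k) ≡ + 0
    term {n} {k} n≢r+s k≤n with k % m ℕ.≟ r % m | (n ∸ k) % m ℕ.≟ s % m
    ... | no k≢r  | _       = ≡.cong (ℤ._* g (n ∸ k)) (off-support p k≢r)
    ... | yes _   | no l≢s  = ≡.trans (≡.cong (f k ℤ.*_) (off-support q l≢s)) (ℤ.*-zeroʳ (f k))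
    ... | yes k≡r | yes l≡s = ⊥-elim (n≢r+s (begin
      n % m                           ≡⟨ ≡.cong (_% m) (ℕ.m+[n∸m]≡n k≤n) ⟨
      (k ℕ.+ (n ∸ k)) % m             ≡⟨ %-distribˡ-+ k (n ∸ k) m ⟩
      (k % m ℕ.+ (n ∸ k) % m) % m     ≡⟨ ≡.cong₂ (λ x y → (x ℕ.+ y) % m) k≡r l≡s ⟩
      (r % m ℕ.+ s % m) % m           ≡⟨ %-distribˡ-+ r s m ⟨
      (r ℕ.+ s) % m                   ∎))

  resp-supported : ∀ {r s f} → r % m ≡ s % m → Supported m r f → Supported m s f
  resp-supported r≡s p = supported λ n≢s → off-support p (λ n≡r → n≢s (≡.trans n≡r r≡s))

-- Steps of 4 serve both moduli: `(4 + n)²` exceeds `n²` by `8(n + 2)`, a multiple of 8 and of 4.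
square-residue : ∀ n → (n ℕ.* n) % 8 ≡ 1 ⊎ (n ℕ.* n) % 4 ≡ 0
square-residue 0 = inj₂ ≡.refl
square-residue 1 = inj₁ ≡.refl
square-residue 2 = inj₂ ≡.refl
square-residue 3 = inj₁ ≡.refl
square-residue (suc (suc (suc (suc n)))) with square-residue n
... | inj₁ odd  = inj₁ (≡.trans (≡.cong (_% 8) (lemma n)) (≡.trans ([m+kn]%n≡m%n (n ℕ.* n) (2 ℕ.+ n) 8) odd))
  where
  lemma : ∀ n → (4 ℕ.+ n) ℕ.* (4 ℕ.+ n) ≡ n ℕ.* n ℕ.+ (2 ℕ.+ n) ℕ.* 8
  lemma = ℕ-Solver.solve-∀
... | inj₂ even = inj₂ (≡.trans (≡.cong (_% 4) (lemma n)) (≡.trans ([m+kn]%n≡m%n (n ℕ.* n) (4 ℕ.+ 2 ℕ.* n) 4) even))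
  where
  lemma : ∀ n → (4 ℕ.+ n) ℕ.* (4 ℕ.+ n) ≡ n ℕ.* n ℕ.+ (4 ℕ.+ 2 ℕ.* n) ℕ.* 4
  lemma = ℕ-Solver.solve-∀

-- Gauss's identity for the actual series and the expansion of the generating function.

module _ (N : ℕ) where

  open CommutativeRing (truncatedRing N) hiding (zero)
  open Algebra.Properties.CommutativeSemiring.Exp commutativeSemiring
  open Gauss (truncatedRing N) (const-morphism N)
  open Solver using (solve; con; _:=_; _:+_; _:*_; _:^_)

  mono-0 : mono 0 ≈ one
  mono-0 = exact (≡.sym ∘ const-1)

  mono-homo : ∀ i j → mono (i ℕ.+ j) ≈ mono i * mono j
  mono-homo i j = exact (mono-+ i j)

  open Theta mono mono-0 mono-homo

  θ : Series
  θ = halfTheta N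

  powS≈^ : ∀ f k → powS f k ≈ f ^ k
  powS≈^ f zero    = refl
  powS≈^ f (suc k) = *-congˡ {x = f} (powS≈^ f k)

  finPoch1≈ : ∀ k → finPoch 1 k ≈ minusProd 0 k
  finPoch1≈ zero    = mono-0
  finPoch1≈ (suc k) = *-cong (finPoch1≈ k) (trans
    (exact (λ n → ≡.trans (≡.cong (λ i → oneMinusQ (suc i) n) (ℕ.+-identityʳ k)) (oneMinusQ≡1-mono k n)))
    (+-congʳ mono-0))

  finPoch2≈ : ∀ k → finPoch 2 k ≈ minusProd² k
  finPoch2≈ zero    = mono-0
  finPoch2≈ (suc k) = *-cong (finPoch2≈ k) (trans (exact (oneMinusQ≡1-mono _)) (+-congʳ mono-0))

  poch≈finPoch : ∀ d → poch (suc d) ≈ finPoch (suc d) N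
  poch≈finPoch d = coeffs λ k≤N → ≡.sym (finPoch-stable d k≤N)

  gauss : poch 2 * (one + const (+ 2) * θ) ≈ poch 1 * poch 1
  gauss = begin
    poch 2 * (one + const (+ 2) * θ)
      ≈⟨ *-congʳ {x = one + const (+ 2) * θ} (trans (poch≈finPoch 1) (finPoch2≈ N)) ⟩
    minusProd² N * theta N
      ≈⟨ minusProd²*theta mono-vanishes ⟩
    minusProd 0 N * minusProd 0 N
      ≈⟨ *-cong p p ⟨
    poch 1 * poch 1 ∎
    where
    open Relation.Binary.Reasoning.Setoid setoid
    p = trans (poch≈finPoch 0) (finPoch1≈ N)
    mono-vanishes : ∀ {k} → N < k → mono k ≈ 0#
    mono-vanishes N<k = coeffs λ j≤N → mono-off (ℕ.>⇒≢ (ℕ.≤-<-trans j≤N N<k))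

  F : Series
  F = pbarNeg 11

  F-inverse : F * (one + const (+ 2) * θ) ^ 11 ≈ 1#
  F-inverse = trans
    (*-congʳ {x = Θ ^ 11} (*-congʳ {x = J} (powS≈^ (poch 2) 11)))
    (quotient-power {poch 1} {poch 2} {J} {Θ} 11 gauss
      (trans (*-congʳ {x = J} (sym (powS≈^ (poch 1) 22))) (exact (⊛-invS (powS (poch 1) 22) ≡.refl))))
    where
    J = invS (powS (poch 1) 22)
    Θ = one + const (+ 2) * θ

  coefficient : F N ≡ const (+ 1) N ℤ.- + 22 ℤ.* θ N ℤ.+ + 264 ℤ.* (θ ^ 2) N ℤ.- + 2288 ℤ.* (θ ^ 3) N
    ℤ.+ + 16016 ℤ.* (θ ^ 4) N ℤ.- + 96096 ℤ.* (θ ^ 5) N ℤ.+ + 64 ℤ.* (F * tail θ) N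
  coefficient = ≡.trans (coeff (inverse-expansion θ F F-inverse) ℕ.≤-refl)
    (expand {a = const (+ 1) N} (const-⊛ (+ 22) θ N) (const-⊛ (+ 264) (θ ^ 2) N) (const-⊛ (+ 2288) (θ ^ 3) N)
      (const-⊛ (+ 16016) (θ ^ 4) N) (const-⊛ (+ 96096) (θ ^ 5) N) (const-⊛ (+ 64) (F * tail θ) N))
    where
    expand : ∀ {a b₁ b₂ b₃ b₄ b₅ b₆ c₁ c₂ c₃ c₄ c₅ c₆} →
      b₁ ≡ c₁ → b₂ ≡ c₂ → b₃ ≡ c₃ → b₄ ≡ c₄ → b₅ ≡ c₅ → b₆ ≡ c₆ →
      a ℤ.- b₁ ℤ.+ b₂ ℤ.- b₃ ℤ.+ b₄ ℤ.- b₅ ℤ.+ b₆ ≡ a ℤ.- c₁ ℤ.+ c₂ ℤ.- c₃ ℤ.+ c₄ ℤ.- c₅ ℤ.+ c₆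
    expand ≡.refl ≡.refl ≡.refl ≡.refl ≡.refl ≡.refl = ≡.refl

  -- Splitting θ into odd and even squares.

  sign-supported : ∀ {m} .{{_ : NonZero m}} n → Supported m 0 (sign n)
  sign-supported zero    = const-supported (+ 1)
  sign-supported (suc n) = ⊖-supported {f = sign n} (sign-supported n)

  term-supported : ∀ {m r} .{{_ : NonZero m}} n → (suc n ℕ.* suc n) % m ≡ r % m →
    Supported m r (sign (suc n) * mono (suc n ℕ.* suc n))
  term-supported n n²≡r = resp-supported n²≡r
    (⊛-supported {f = sign (suc n)} {g = mono (suc n ℕ.* suc n)}
      (sign-supported (suc n)) (mono-supported (suc n ℕ.* suc n)))

  -- By induction on `n`; `square-residue` decides which of the two parts receives the new term.
  halfTheta-split : ∀ n → Σ[ a ∈ Series ] Σ[ b ∈ Series ]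
    halfTheta n ≈ a + b × Supported 8 1 a × Supported 4 0 b
  halfTheta-split zero = 0# , const (+ 0) , sym (+-identityˡ (const (+ 0))) , supported (λ _ → ≡.refl) , const-supported (+ 0)
  halfTheta-split (suc n) with halfTheta-split n | square-residue (suc n)
  ... | a , b , h≈a+b , a-supp , b-supp | inj₁ odd =
    a + e , b , trans (+-congʳ {x = e} h≈a+b) (solve 3 (λ a b e → a :+ b :+ e := a :+ e :+ b) refl a b e) ,
    ⊕-supported {f = a} {g = e} a-supp (term-supported n odd) , b-supp
    where
    e = sign (suc n) * mono (suc n ℕ.* suc n)
  ... | a , b , h≈a+b , a-supp , b-supp | inj₂ even =
    a , b + e , trans (+-congʳ {x = e} h≈a+b) (+-assoc a b e) ,
    a-supp , ⊕-supported {f = b} {g = e} b-supp (term-supported n even)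
    where
    e = sign (suc n) * mono (suc n ℕ.* suc n)

  θ-odd θ-even : Series
  θ-odd  = let a , _ = halfTheta-split N in a
  θ-even = let _ , b , _ = halfTheta-split N in b

  θ≈odd+even : θ ≈ θ-odd + θ-even
  θ≈odd+even = let _ , _ , p , _ = halfTheta-split N in p

  θ-odd-supported₈ : Supported 8 1 θ-odd
  θ-odd-supported₈ = let _ , _ , _ , p , _ = halfTheta-split N in p

  -- Weakening the modulus from 8 to 4 gives both parts the same modulus, as `⊛-supported` requires
  -- for their products.
  θ-odd-supported₄ : Supported 4 1 θ-odd
  θ-odd-supported₄ = supported λ {n} n≢1 → off-support θ-odd-supported₈ λ n≡1 →
    n≢1 (≡.trans (≡.sym (m∣n⇒o%n%m≡o%m 4 8 n (ℕ.divides 2 ≡.refl))) (≡.cong (_% 4) n≡1))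

  θ-even-supported : Supported 4 0 θ-even
  θ-even-supported = let _ , _ , _ , _ , p = halfTheta-split N in p

  -- Coefficients of the powers of θ by residue class.

  ^-supported : ∀ {m r f} .{{_ : NonZero m}} k → Supported m r f → Supported m (k ℕ.* r) (f ^ k)
  ^-supported zero            p = oneS-supported
  ^-supported {f = f} (suc k) p = ⊛-supported {f = f} {g = f ^ k} p (^-supported k p)

  monomial : ℕ → ℕ → Series
  monomial i j = θ-odd ^ i * θ-even ^ j

  -- All exponents in `θ-odd ^ i * θ-even ^ j` are congruent to `i` modulo 4; the residue keeps the
  -- form in which `^-supported` and `⊛-supported` produce it.
  monomial-vanish : ∀ {r} i j → N % 4 ≡ r → r ≢ (i ℕ.* 1 ℕ.+ j ℕ.* 0) % 4 → monomial i j N ≡ + 0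
  monomial-vanish i j N≡r r≢ = off-support (⊛-supported {f = θ-odd ^ i} {g = θ-even ^ j}
    (^-supported {f = θ-odd} i θ-odd-supported₄) (^-supported {f = θ-even} j θ-even-supported)) {N}
    (r≢ ∘ ≡.trans (≡.sym N≡r))

  scaled-vanish : ∀ {r} c i j → N % 4 ≡ r → r ≢ (i ℕ.* 1 ℕ.+ j ℕ.* 0) % 4 → (const c * monomial i j) N ≡ + 0
  scaled-vanish c i j N≡r r≢ = ≡.trans (const-⊛ c (monomial i j) N)
    (≡.trans (≡.cong (c ℤ.*_) (monomial-vanish i j N≡r r≢)) (ℤ.*-zeroʳ c))

  -- Modulo 4 the exponents of `θ-odd ^ 3` cannot be told from 7; modulo 8 they are 3.
  θ-odd³-vanish : N % 8 ≡ 7 → monomial 3 0 N ≡ + 0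
  θ-odd³-vanish N≡7 = ≡.trans (coeff (*-identityʳ (θ-odd ^ 3)) ℕ.≤-refl)
    (off-support (^-supported {f = θ-odd} 3 θ-odd-supported₈) {N} λ N≡3 → 7≢3 (≡.trans (≡.sym N≡7) N≡3))
    where
    7≢3 : 7 ≢ 3
    7≢3 ()

  θ-vanish : ∀ {r} → N % 4 ≡ r → r ≢ 1 → r ≢ 0 → θ N ≡ + 0
  θ-vanish N≡r r≢1 r≢0 = ≡.trans
    -- Zeroth powers are inserted so that every term has the shape of a `monomial`.
    (coeff (trans θ≈odd+even (solve 2 (λ a b → a :+ b := a :^ 1 :* b :^ 0 :+ a :^ 0 :* b :^ 1) refl θ-odd θ-even)) ℕ.≤-refl)
    (≡.cong₂ ℤ._+_ (monomial-vanish 1 0 N≡r r≢1) (monomial-vanish 0 1 N≡r r≢0))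

  θ²-vanish : N % 4 ≡ 3 → (θ ^ 2) N ≡ + 0
  θ²-vanish N≡3 = ≡.trans
    (coeff (trans (^-congˡ 2 θ≈odd+even) (solve 2 (λ a b → (a :+ b) :^ 2 :=
      a :^ 2 :* b :^ 0 :+ con (+ 2) :* (a :^ 1 :* b :^ 1) :+ a :^ 0 :* b :^ 2) refl θ-odd θ-even)) ℕ.≤-refl)
    (≡.cong₂ ℤ._+_ (≡.cong₂ ℤ._+_
      (monomial-vanish 2 0 N≡3 λ ()) (scaled-vanish (+ 2) 1 1 N≡3 λ ())) (monomial-vanish 0 2 N≡3 λ ()))

  θ³-vanish : N % 8 ≡ 7 → N % 4 ≡ 3 → (θ ^ 3) N ≡ + 0
  θ³-vanish N≡7 N≡3 = ≡.trans
    (coeff (trans (^-congˡ 3 θ≈odd+even) (solve 2 (λ a b → (a :+ b) :^ 3 :=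
      a :^ 3 :* b :^ 0 :+ con (+ 3) :* (a :^ 2 :* b :^ 1) :+ con (+ 3) :* (a :^ 1 :* b :^ 2) :+ a :^ 0 :* b :^ 3) refl θ-odd θ-even)) ℕ.≤-refl)
    (≡.cong₂ ℤ._+_ (≡.cong₂ ℤ._+_ (≡.cong₂ ℤ._+_
      (θ-odd³-vanish N≡7) (scaled-vanish (+ 3) 2 1 N≡3 λ ())) (scaled-vanish (+ 3) 1 2 N≡3 λ ())) (monomial-vanish 0 3 N≡3 λ ()))

  -- Among `a^i b^(4-i)` only `i = 3` matches the residue 3 modulo 4. The expansion lists that term
  -- last, so the vanishing ones collapse to a zero on its left.
  θ⁴-coefficient : N % 4 ≡ 3 → (θ ^ 4) N ≡ + 4 ℤ.* monomial 3 1 N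
  θ⁴-coefficient N≡3 = ≡.trans
    (coeff (trans (^-congˡ 4 θ≈odd+even) (solve 2 (λ a b → (a :+ b) :^ 4 :=
      (a :^ 4 :* b :^ 0 :+ con (+ 6) :* (a :^ 2 :* b :^ 2) :+ con (+ 4) :* (a :^ 1 :* b :^ 3) :+ a :^ 0 :* b :^ 4)
      :+ con (+ 4) :* (a :^ 3 :* b :^ 1)) refl θ-odd θ-even)) ℕ.≤-refl)
    (≡.trans (≡.cong₂ ℤ._+_ (≡.cong₂ ℤ._+_ (≡.cong₂ ℤ._+_ (≡.cong₂ ℤ._+_
      (monomial-vanish 4 0 N≡3 λ ()) (scaled-vanish (+ 6) 2 2 N≡3 λ ())) (scaled-vanish (+ 4) 1 3 N≡3 λ ()))
      (monomial-vanish 0 4 N≡3 λ ())) (const-⊛ (+ 4) (monomial 3 1) N)) (ℤ.+-identityˡ _))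

  -- As for the fourth power: `i = 3` is the only `i ≤ 5` congruent to 3 modulo 4.
  θ⁵-coefficient : N % 4 ≡ 3 → (θ ^ 5) N ≡ + 10 ℤ.* monomial 3 2 N
  θ⁵-coefficient N≡3 = ≡.trans
    (coeff (trans (^-congˡ 5 θ≈odd+even) (solve 2 (λ a b → (a :+ b) :^ 5 :=
      (a :^ 5 :* b :^ 0 :+ con (+ 5) :* (a :^ 4 :* b :^ 1) :+ con (+ 10) :* (a :^ 2 :* b :^ 3)
        :+ con (+ 5) :* (a :^ 1 :* b :^ 4) :+ a :^ 0 :* b :^ 5)
      :+ con (+ 10) :* (a :^ 3 :* b :^ 2)) refl θ-odd θ-even)) ℕ.≤-refl)
    (≡.trans (≡.cong₂ ℤ._+_ (≡.cong₂ ℤ._+_ (≡.cong₂ ℤ._+_ (≡.cong₂ ℤ._+_ (≡.cong₂ ℤ._+_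
      (monomial-vanish 5 0 N≡3 λ ()) (scaled-vanish (+ 5) 4 1 N≡3 λ ())) (scaled-vanish (+ 10) 2 3 N≡3 λ ()))
      (scaled-vanish (+ 5) 1 4 N≡3 λ ())) (monomial-vanish 0 5 N≡3 λ ()))
      (const-⊛ (+ 10) (monomial 3 2) N)) (ℤ.+-identityˡ _))

  -- Divisibility of the coefficients.

  constant-term-vanish : ∀ {r} → N % 8 ≡ r → r ≢ 0 → const (+ 1) N ≡ + 0
  constant-term-vanish N≡r r≢0 = off-support (const-supported {8} (+ 1)) {N} (r≢0 ∘ ≡.trans (≡.sym N≡r))

  -- Term by term in `coefficient`: `r ≢ 0` removes the constant term, and `d ∣ₛ + 64` takes care of
  -- the remainder with `tail`.
  ∣-coefficient : ∀ d {r} → N % 8 ≡ r → r ≢ 0 →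
    d ∣ₛ + 22 ℤ.* θ N → d ∣ₛ + 264 ℤ.* (θ ^ 2) N → d ∣ₛ + 2288 ℤ.* (θ ^ 3) N → d ∣ₛ + 16016 ℤ.* (θ ^ 4) N →
    d ∣ₛ + 96096 ℤ.* (θ ^ 5) N → d ∣ₛ + 64 → d ∣ pbarNeg 11 N
  ∣-coefficient d N≡r r≢0 h₁ h₂ h₃ h₄ h₅ h₆ = Signed.∣⇒∣ᵤ {d} {F N} (≡.subst (d ∣ₛ_) (≡.sym coefficient)
    (Signed.∣m∣n⇒∣m+n (Signed.∣m∣n⇒∣m-n (Signed.∣m∣n⇒∣m+n (Signed.∣m∣n⇒∣m-n (Signed.∣m∣n⇒∣m+n (Signed.∣m∣n⇒∣m-n
      (≡.subst (d ∣ₛ_) (≡.sym (constant-term-vanish N≡r r≢0)) (Signed.divides (+ 0) ≡.refl))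
      h₁) h₂) h₃) h₄) h₅) (Signed.∣m⇒∣m*n ((F * tail θ) N) h₆)))

  ∣-multiple : ∀ q d x → d ∣ₛ q ℤ.* d ℤ.* x
  ∣-multiple q d x = Signed.∣m⇒∣m*n x (Signed.divides q ≡.refl)

  ∣-vanishing : ∀ d c {x} → x ≡ + 0 → d ∣ₛ c ℤ.* x
  ∣-vanishing d c ≡.refl = Signed.∣n⇒∣m*n c (Signed.divides (+ 0) ≡.refl)

  -- For the case where `c` alone is not a multiple of `d` and the factor `k` of `x` supplies the
  -- rest.
  ∣-factored : ∀ q d c k {x} y → q ℤ.* d ≡ c ℤ.* k → x ≡ k ℤ.* y → d ∣ₛ c ℤ.* x
  ∣-factored q d c k y qd≡ck ≡.refl =
    ≡.subst (d ∣ₛ_) (ℤ.*-assoc c k y) (Signed.∣m⇒∣m*n y (Signed.divides q (≡.sym qd≡ck)))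

  2∣coefficient : ∀ {r} → N % 8 ≡ r → r ≢ 0 → + 2 ∣ pbarNeg 11 N
  2∣coefficient N≡r r≢0 = ∣-coefficient (+ 2) N≡r r≢0
    (∣-multiple (+ 11) (+ 2) (θ N)) (∣-multiple (+ 132) (+ 2) ((θ ^ 2) N)) (∣-multiple (+ 1144) (+ 2) ((θ ^ 3) N))
    (∣-multiple (+ 8008) (+ 2) ((θ ^ 4) N)) (∣-multiple (+ 48048) (+ 2) ((θ ^ 5) N)) (Signed.divides (+ 32) ≡.refl)

  %4-from-%8 : ∀ {r} → N % 8 ≡ r → N % 4 ≡ r % 4
  %4-from-%8 N≡r = ≡.trans (≡.sym (m∣n⇒o%n%m≡o%m 4 8 N (ℕ.divides 2 ≡.refl))) (≡.cong (_% 4) N≡r)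

  8∣coefficient : N % 8 ≡ 2 → + 8 ∣ pbarNeg 11 N
  8∣coefficient N≡2 = ∣-coefficient (+ 8) N≡2 (λ ())
    -- 8 does not divide 22, so here θ has to vanish; from 264 = 33 · 8 on, the binomial
    -- coefficients suffice.
    (∣-vanishing (+ 8) (+ 22) (θ-vanish (%4-from-%8 N≡2) (λ ()) (λ ())))
    (∣-multiple (+ 33) (+ 8) ((θ ^ 2) N)) (∣-multiple (+ 286) (+ 8) ((θ ^ 3) N))
    (∣-multiple (+ 2002) (+ 8) ((θ ^ 4) N)) (∣-multiple (+ 12012) (+ 8) ((θ ^ 5) N)) (Signed.divides (+ 8) ≡.refl)

  16∣coefficient : N % 8 ≡ 3 → + 16 ∣ pbarNeg 11 N
  16∣coefficient N≡3 = ∣-coefficient (+ 16) N≡3 (λ ())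
    (∣-vanishing (+ 16) (+ 22) (θ-vanish (%4-from-%8 N≡3) (λ ()) (λ ())))
    -- 264 has only the factor 8, whereas 2288 = 143 · 16 and the later coefficients are multiples
    -- of 16.
    (∣-vanishing (+ 16) (+ 264) (θ²-vanish (%4-from-%8 N≡3))) (∣-multiple (+ 143) (+ 16) ((θ ^ 3) N))
    (∣-multiple (+ 1001) (+ 16) ((θ ^ 4) N)) (∣-multiple (+ 6006) (+ 16) ((θ ^ 5) N)) (Signed.divides (+ 4) ≡.refl)

  64∣coefficient : N % 8 ≡ 7 → + 64 ∣ pbarNeg 11 N
  64∣coefficient N≡7 = ∣-coefficient (+ 64) N≡7 (λ ())
    (∣-vanishing (+ 64) (+ 22) (θ-vanish N≡3 (λ ()) (λ ())))
    (∣-vanishing (+ 64) (+ 264) (θ²-vanish N≡3))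
    (∣-vanishing (+ 64) (+ 2288) (θ³-vanish N≡7 N≡3))
    -- 16016 = 1001 · 2^4 and 96096 = 3003 · 2^5; the missing powers of 2 come from the factors 4
    -- and 10 of the surviving terms.
    (∣-factored (+ 1001) (+ 64) (+ 16016) (+ 4) (monomial 3 1 N) ≡.refl (θ⁴-coefficient N≡3))
    (∣-factored (+ 15015) (+ 64) (+ 96096) (+ 10) (monomial 3 2 N) ≡.refl (θ⁵-coefficient N≡3))
    (Signed.divides (+ 1) ≡.refl)
    where
    N≡3 : N % 4 ≡ 3
    N≡3 = %4-from-%8 N≡7

-- Specialisation to the progressions modulo 8.

residue : ∀ n r → (8 ℕ.* n ℕ.+ r) % 8 ≡ r % 8
residue n r = ≡.trans (≡.cong (_% 8) (≡.trans (ℕ.+-comm (8 ℕ.* n) r) (≡.cong (r ℕ.+_) (ℕ.*-comm 8 n))))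
  ([m+kn]%n≡m%n r n 8)

open import Data.Nat using (_*_; _+_)

theorem1p3 : (n : ℕ) →
    ((+ 2) ∣ pbarNeg 11 (8 * n + 1)) ×
    ((+ 8) ∣ pbarNeg 11 (8 * n + 2)) ×
    ((+ 16) ∣ pbarNeg 11 (8 * n + 3)) ×
    ((+ 2) ∣ pbarNeg 11 (8 * n + 4)) ×
    ((+ 64) ∣ pbarNeg 11 (8 * n + 7))
theorem1p3 n =
  2∣coefficient (8 * n + 1) (residue n 1) (λ ()) ,
  8∣coefficient (8 * n + 2) (residue n 2) ,
  16∣coefficient (8 * n + 3) (residue n 3) ,
  2∣coefficient (8 * n + 4) (residue n 4) (λ ()) ,
  64∣coefficient (8 * n + 7) (residue n 7)
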